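{- Let $A$ be adequate, $\beta\in\Gamma$, and suppose that $A$ is $\beta$-closed, i.e. for all $M\in A$, $M\cap\beta\in A$. Let $B$ be adequate such that $A\cap P(\beta)\subseteq B\subseteq P(\beta)$, where $P(\beta)$ is the power set of $\beta$. Then $A\cup B$ is adequate.
   Context: Standing assumptions and notation. Assume $2^{\omega_1}=\omega_2$ and fix a bijection $\pi:\omega_2\to H(\omega_2)$. $P_{\omega_1}(\omega_2)$ is the set of countable subsets of $\omega_2$. Assume there is a stationary set $\mathcal{Y}\subseteq P_{\omega_1}(\omega_2)$ which is thin, i.e. for all $\beta<\omega_2$ the set $\{a\cap\beta: a\in\mathcal{Y}\}$ has size at most $\omega_1$; fix such a $\mathcal{Y}$ which is moreover closed under initial segments ($a\in\mathcal{Y}$, $\beta<\omega_2$ imply $a\cap\beta\in\mathcal{Y}$). Let $\mathcal{A}$ be the structure $(H(\omega_2),\in,\pi,\mathcal{Y})$, which has definable Skolem functions (via the well-ordering induced by $\pi$). For $a\subseteq H(\omega_2)$, $Sk(a)$ is the closure of $a$ under a fixed set of definable Skolem functions for $\mathcal{A}$. Let $C$ be the (club) set of $\beta<\omega_2$ with $Sk(\beta)\cap\omega_2=\beta$, and let $\Lambda$ be the set of $\beta<\omega_2$ of cofinality $\omega_1$ which are limit points of $C$. Let $\mathcal{X}$ be the set of $M\in\mathcal{Y}$ such that $Sk(M)\cap\omega_2=M$ and for all $\gamma\in M$, $\sup(C\cap\gamma)\in M$. Comparison points and adequacy. Fix a set $\Gamma\subseteq\Lambda$ which is stationary in $\omega_2$.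 For $M\in\mathcal{X}$, $\Gamma_M$ is the set of $\beta\in\Gamma$ such that $\beta=\min(\Gamma\setminus\sup(M\cap\beta))$, i.e. $\Gamma\cap[\sup(M\cap\beta),\beta)=\emptyset$. For $M,N\in\mathcal{X}$, $\Gamma_M\cap\Gamma_N$ has a largest element, denoted $\beta_{M,N}$. A set $A\subseteq\mathcal{X}$ is adequate if for all $M,N\in A$, either $M\cap\beta_{M,N}=N\cap\beta_{M,N}$, or $M\cap\beta_{M,N}\in Sk(N)$, or $N\cap\beta_{M,N}\in Sk(M)$. -}

module Defs where

open import Level using (Level; suc)
open import Data.Fin.Base using (Fin)
open import Data.Nat.Base using (ℕ) renaming (suc to 1+_)
open import Data.Product using (Σ; ∃-syntax; ∃!; _×_; _,_; proj₁; proj₂)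
open import Data.Sum using (_⊎_)
open import Data.Vec.Base using (Vec; _∷_; lookup)
open import Function.Bundles using (_⇔_)
open import Relation.Binary.PropositionalEquality using (_≡_)
open import Relation.Nullary using (¬_)

-- A universe of sets satisfying ZFC. Separation and replacement range over
-- all Agda-definable predicates and relations; in particular ω is standard,
-- so finite tuples and formulas may be taken to be Agda's own.

record ZFC (ℓ : Level) : Set (suc ℓ) where
  infix 4 _∈_ _∉_ _⊆_
  field
    V   : Set ℓ
    _∈_ : V → V → Set ℓ

  _∉_ : V → V → Set ℓ
  x ∉ y = ¬ (x ∈ y)

  _⊆_ : V → V → Set ℓ
  x ⊆ y = ∀ {z} → z ∈ x → z ∈ y

  Empty : V → Set ℓ
  Empty x = ∀ y → y ∉ x

  field
    extensionality : ∀ {x y} → (∀ z → z ∈ x ⇔ z ∈ y) → x ≡ y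
    foundation     : ∀ x → (∃[ y ] y ∈ x) → ∃[ y ] (y ∈ x × (∀ {z} → z ∈ x → z ∉ y))
    emptySet       : ∃[ e ] Empty e
    pairing        : ∀ x y → ∃[ p ] (∀ z → z ∈ p ⇔ (z ≡ x ⊎ z ≡ y))
    union          : ∀ x → ∃[ u ] (∀ z → z ∈ u ⇔ (∃[ y ] (y ∈ x × z ∈ y)))
    powerSet       : ∀ x → ∃[ p ] (∀ z → z ∈ p ⇔ (z ⊆ x))
    infinity       : ∃[ i ] ((∀ {e} → Empty e → e ∈ i) ×
                             (∀ {x y} → x ∈ i → (∀ z → z ∈ y ⇔ (z ∈ x ⊎ z ≡ x)) → y ∈ i))
    separation     : ∀ x (P : V → Set ℓ) → ∃[ s ] (∀ z → z ∈ s ⇔ (z ∈ x × P z))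
    replacement    : ∀ x (R : V → V → Set ℓ) →
                     (∀ {u v w} → u ∈ x → R u v → R u w → v ≡ w) →
                     ∃[ r ] (∀ v → v ∈ r ⇔ (∃[ u ] (u ∈ x × R u v)))
    choice         : ∀ x → (∀ {y} → y ∈ x → ∃[ z ] z ∈ y) →
                     (∀ {y y′ z} → y ∈ x → y′ ∈ x → z ∈ y → z ∈ y′ → y ≡ y′) →
                     ∃[ c ] (∀ {y} → y ∈ x → ∃! _≡_ (λ z → z ∈ y × z ∈ c))

module SetTheory {ℓ : Level} (U : ZFC ℓ) where
  open ZFC U public

  infixr 7 _∩_
  infixr 6 _∪_ _∖_
  infix  4 _≤_ _≼_ _≺_ _≈_

  pair : V → V → V
  pair x y = proj₁ (pairing x y)

  ⋃ : V → V
  ⋃ x = proj₁ (union x)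

  𝒫 : V → V
  𝒫 x = proj₁ (powerSet x)

  sep : V → (V → Set ℓ) → V
  sep x P = proj₁ (separation x P)

  _∪_ : V → V → V
  x ∪ y = ⋃ (pair x y)

  _∩_ : V → V → V
  x ∩ y = sep x (_∈ y)

  _∖_ : V → V → V
  x ∖ y = sep x (_∉ y)

  ⟨_,_⟩ : V → V → V
  ⟨ x , y ⟩ = pair (pair x x) (pair x y)

  Inductive : V → Set ℓ
  Inductive i = (∀ {e} → Empty e → e ∈ i) × (∀ {x} → x ∈ i → x ∪ pair x x ∈ i)

  ω : V
  ω = sep (proj₁ infinity) (λ n → ∀ {i} → Inductive i → n ∈ i)

  record IsFunction (f a b : V) : Set ℓ where
    field
      graph      : ∀ {p} → p ∈ f → ∃[ x ] ∃[ y ] (x ∈ a × y ∈ b × p ≡ ⟨ x , y ⟩)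
      total      : ∀ {x} → x ∈ a → ∃[ y ] ⟨ x , y ⟩ ∈ f
      functional : ∀ {x y z} → ⟨ x , y ⟩ ∈ f → ⟨ x , z ⟩ ∈ f → y ≡ z

  IsInjection : V → V → V → Set ℓ
  IsInjection f a b =
    IsFunction f a b × (∀ {x x′ y} → ⟨ x , y ⟩ ∈ f → ⟨ x′ , y ⟩ ∈ f → x ≡ x′)

  IsBijection : V → V → V → Set ℓ
  IsBijection f a b =
    IsInjection f a b × (∀ {y} → y ∈ b → ∃[ x ] ⟨ x , y ⟩ ∈ f)

  _≼_ : V → V → Set ℓ
  a ≼ b = ∃[ f ] IsInjection f a b

  _≺_ : V → V → Set ℓ
  a ≺ b = a ≼ b × ¬ (b ≼ a)

  _≈_ : V → V → Set ℓ
  a ≈ b = ∃[ f ] IsBijection f a b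

  Countable : V → Set ℓ
  Countable a = a ≼ ω

  Transitive : V → Set ℓ
  Transitive x = ∀ {y} → y ∈ x → y ⊆ x

  -- Well-foundedness of ∈ on x is supplied by the axiom of foundation.
  Ordinal : V → Set ℓ
  Ordinal x = Transitive x × (∀ {y z} → y ∈ x → z ∈ x → y ∈ z ⊎ y ≡ z ⊎ z ∈ y)

  _≤_ : V → V → Set ℓ
  α ≤ β = α ∈ β ⊎ α ≡ β

  IsLeast : V → V → Set ℓ
  IsLeast s α = α ∈ s × (∀ {γ} → γ ∈ s → α ≤ γ)

  IsLargest : V → V → Set ℓ
  IsLargest s α = α ∈ s × (∀ {γ} → γ ∈ s → γ ≤ α)

  -- For a set of von Neumann ordinals the supremum is the union; sup ∅ = 0.
  sup : V → V
  sup = ⋃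

  -- μ is the least ordinal that does not inject into κ.
  IsCardinalSuccessor : V → V → Set ℓ
  IsCardinalSuccessor κ μ = Ordinal μ × ¬ (μ ≼ κ) × (∀ {α} → α ∈ μ → α ≼ κ)

  IsTransitiveClosure : V → V → Set ℓ
  IsTransitiveClosure x t =
    Transitive t × x ⊆ t × (∀ {s} → Transitive s → x ⊆ s → t ⊆ s)

  -- x belongs to H(κ).
  HereditarilySmaller : V → V → Set ℓ
  HereditarilySmaller κ x = ∃[ t ] (IsTransitiveClosure x t × t ≺ κ)

  IsLimitPoint : V → V → Set ℓ
  IsLimitPoint c δ =
    (∃[ α ] α ∈ δ) × (∀ {α} → α ∈ δ → ∃[ γ ] (γ ∈ c × γ ∈ δ × α ∈ γ))

  IsClub : V → V → Set ℓ
  IsClub κ c =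
    c ⊆ κ ×
    (∀ {α} → α ∈ κ → ∃[ γ ] (γ ∈ c × α ∈ γ)) ×
    (∀ {δ} → δ ∈ κ → IsLimitPoint c δ → δ ∈ c)

  IsStationary : V → V → Set ℓ
  IsStationary κ s = s ⊆ κ × (∀ {c} → IsClub κ c → ∃[ α ] (α ∈ s × α ∈ c))

  CofinalMap : V → V → V → Set ℓ
  CofinalMap f α β =
    IsFunction f α β ×
    (∀ {ξ} → ξ ∈ β → ∃[ i ] ∃[ η ] (⟨ i , η ⟩ ∈ f × ξ ≤ η))

  HasCofinality : V → V → Set ℓ
  HasCofinality β κ =
    Ordinal κ × (∃[ f ] CofinalMap f κ β) ×
    (∀ {α} → Ordinal α → (∃[ f ] CofinalMap f α β) → κ ≤ α)

  countableSubsets : V → V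
  countableSubsets x = sep (𝒫 x) Countable

  -- Closure under unions of nonempty countable ⊆-chains is the usual closure
  -- under unions of increasing ω-sequences.
  IsClubCountable : V → V → Set ℓ
  IsClubCountable x d =
    d ⊆ countableSubsets x ×
    (∀ {a} → a ∈ countableSubsets x → ∃[ b ] (b ∈ d × a ⊆ b)) ×
    (∀ {e} → e ⊆ d → (∃[ a ] a ∈ e) → Countable e →
       (∀ {a b} → a ∈ e → b ∈ e → a ⊆ b ⊎ b ⊆ a) → ⋃ e ∈ d)

  IsStationaryCountable : V → V → Set ℓ
  IsStationaryCountable x s =
    s ⊆ countableSubsets x ×
    (∀ {d} → IsClubCountable x d → ∃[ a ] (a ∈ s × a ∈ d))

-- First-order formulas, with free variables in Fin n, in the language of
-- (H(ω₂), ∈, π, 𝒴); piF i j says that π maps the i-th variable to the j-th.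

data Formula (n : ℕ) : Set where
  eqF memF piF : Fin n → Fin n → Formula n
  yF           : Fin n → Formula n
  notF         : Formula n → Formula n
  andF         : Formula n → Formula n → Formula n
  exF          : Formula (1+ n) → Formula n

module Structure {ℓ : Level} (U : ZFC ℓ) (H π 𝒴 : ZFC.V U) where
  open SetTheory U

  Sat : ∀ {n} → Formula n → Vec V n → Set ℓ
  Sat (eqF i j)  ρ = lookup ρ i ≡ lookup ρ j
  Sat (memF i j) ρ = lookup ρ i ∈ lookup ρ j
  Sat (piF i j)  ρ = ⟨ lookup ρ i , lookup ρ j ⟩ ∈ π
  Sat (yF i)     ρ = lookup ρ i ∈ 𝒴
  Sat (notF φ)   ρ = ¬ Sat φ ρ
  Sat (andF φ χ) ρ = Sat φ ρ × Sat χ ρ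
  Sat (exF φ)    ρ = ∃[ x ] (x ∈ H × Sat φ (x ∷ ρ))

  _∈*_ : ∀ {n} → Vec V n → V → Set ℓ
  xs ∈* a = ∀ i → lookup xs i ∈ a

  -- Variable 0 of φ is the one being witnessed. Only the values of the
  -- functions on H are constrained (and used).
  record SkolemFunctions : Set ℓ where
    field
      sk           : ∀ {n} → Formula (1+ n) → Vec V n → V
      sk-in-H      : ∀ {n} (φ : Formula (1+ n)) {xs} → xs ∈* H → sk φ xs ∈ H
      sk-witness   : ∀ {n} (φ : Formula (1+ n)) {xs} → xs ∈* H →
                     (∃[ y ] (y ∈ H × Sat φ (y ∷ xs))) → Sat φ (sk φ xs ∷ xs)
      sk-definable : ∀ {n} (φ : Formula (1+ n)) →
                     Σ (Formula (1+ n)) λ ψ →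
                     ∀ {xs y} → xs ∈* H → y ∈ H → Sat ψ (y ∷ xs) ⇔ (y ≡ sk φ xs)

  module Hull (F : SkolemFunctions) where
    open SkolemFunctions F

    data SkClosure (a : V) : V → Set ℓ where
      base : ∀ {x} → x ∈ a → SkClosure a x
      step : ∀ {n} (φ : Formula (1+ n)) (xs : Vec V n) →
             (∀ i → SkClosure a (lookup xs i)) → SkClosure a (sk φ xs)

    -- For a ⊆ H the closure stays inside H, so cutting down to H only serves
    -- to make it a set.
    Sk : V → V
    Sk a = sep H (SkClosure a)

record Setting {ℓ : Level} (U : ZFC ℓ) : Set ℓ where
  open SetTheory U

  field
    ω₁ ω₂ : V
    isω₁  : IsCardinalSuccessor ω ω₁
    isω₂  : IsCardinalSuccessor ω₁ ω₂

    2^ω₁≈ω₂ : 𝒫 ω₁ ≈ ω₂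

    H   : V
    isH : ∀ x → x ∈ H ⇔ HereditarilySmaller ω₂ x

    π   : V
    isπ : IsBijection π ω₂ H

    𝒴            : V
    𝒴-stationary : IsStationaryCountable ω₂ 𝒴
    𝒴-thin       : ∀ {β} → β ∈ ω₂ → sep (𝒫 β) (λ x → ∃[ a ] (a ∈ 𝒴 × x ≡ a ∩ β)) ≼ ω₁
    𝒴-initial    : ∀ {a β} → a ∈ 𝒴 → β ∈ ω₂ → a ∩ β ∈ 𝒴

  open Structure U H π 𝒴

  field
    skolemFunctions : SkolemFunctions

  open Hull skolemFunctions public

  C : V
  C = sep ω₂ (λ β → Sk β ∩ ω₂ ≡ β)

  Λ : V
  Λ = sep ω₂ (λ β → HasCofinality β ω₁ × IsLimitPoint C β)

  𝒳 : V
  𝒳 = sep 𝒴 (λ M → Sk M ∩ ω₂ ≡ M × (∀ {γ} → γ ∈ M → sup (C ∩ γ) ∈ M))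

  field
    Γ            : V
    Γ⊆Λ          : Γ ⊆ Λ
    Γ-stationary : IsStationary ω₂ Γ

  Γ[_] : V → V
  Γ[ M ] = sep Γ (λ β → IsLeast (Γ ∖ sup (M ∩ β)) β)

  -- Comparison points are unique, and exist for all M, N ∈ 𝒳, so the
  -- existential quantifier in Adequate is a definite description.
  IsComparisonPoint : V → V → V → Set ℓ
  IsComparisonPoint M N β = IsLargest (Γ[ M ] ∩ Γ[ N ]) β

  Adequate : V → Set ℓ
  Adequate A =
    A ⊆ 𝒳 ×
    (∀ {M N} → M ∈ A → N ∈ A →
       ∃[ β ] (IsComparisonPoint M N β ×
               (M ∩ β ≡ N ∩ β ⊎ M ∩ β ∈ Sk N ⊎ N ∩ β ∈ Sk M)))

  Closed : V → V → Set ℓ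
  Closed β A = ∀ {M} → M ∈ A → M ∩ β ∈ A

{-# OPTIONS --safe #-}

-- The key point is β_{M,N} = β_{M∩β,N} whenever N ⊆ β: no element of Γ_N lies
-- above β, since β itself belongs to Γ ∖ sup N, and up to β the sets M and
-- M ∩ β have the same initial segments. Adequacy of B for the pair
-- M ∩ β, N therefore transfers to M, N, because Sk is monotone.

module Submission where

open import Axiom.ExcludedMiddle using (ExcludedMiddle)
open import Data.Empty using (⊥-elim)
open import Data.Product using (∃-syntax; _×_; _,_; proj₁; proj₂; swap; map₂)
open import Data.Sum using (_⊎_; inj₁; inj₂; [_,_]′; map) renaming (swap to ⊎-swap)
open import Function.Base using (id; _∘_)
open import Function.Bundles using (_⇔_; mk⇔; Equivalence)
open import Level using (Level)
open import Relation.Binary.PropositionalEquality using (_≡_; refl; sym; trans; subst)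
open import Relation.Nullary using (¬_)
open import Defs

open Equivalence using (to; from)

module SetLemmas {ℓ : Level} (U : ZFC ℓ) where
  open SetTheory U

  ∈-pair : ∀ {x y z} → z ∈ pair x y ⇔ (z ≡ x ⊎ z ≡ y)
  ∈-pair {x} {y} {z} = proj₂ (pairing x y) z

  ∈-⋃ : ∀ {x z} → z ∈ ⋃ x ⇔ (∃[ y ] (y ∈ x × z ∈ y))
  ∈-⋃ {x} {z} = proj₂ (union x) z

  ∈-𝒫 : ∀ {x z} → z ∈ 𝒫 x ⇔ (z ⊆ x)
  ∈-𝒫 {x} {z} = proj₂ (powerSet x) z

  ∈-sep : ∀ {x z} {P : V → Set ℓ} → z ∈ sep x P ⇔ (z ∈ x × P z)
  ∈-sep {x} {z} {P} = proj₂ (separation x P) z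

  ∈-∩ : ∀ {x y z} → z ∈ x ∩ y ⇔ (z ∈ x × z ∈ y)
  ∈-∩ = ∈-sep

  ∈-∪ : ∀ {x y z} → z ∈ x ∪ y ⇔ (z ∈ x ⊎ z ∈ y)
  ∈-∪ {x} {y} {z} = mk⇔ split join
    where
    split : z ∈ x ∪ y → z ∈ x ⊎ z ∈ y
    split z∈ with to ∈-⋃ z∈
    ... | w , w∈ , z∈w with to ∈-pair w∈
    ...   | inj₁ refl = inj₁ z∈w
    ...   | inj₂ refl = inj₂ z∈w

    join : z ∈ x ⊎ z ∈ y → z ∈ x ∪ y
    join (inj₁ z∈x) = from ∈-⋃ (x , from ∈-pair (inj₁ refl) , z∈x)
    join (inj₂ z∈y) = from ∈-⋃ (y , from ∈-pair (inj₂ refl) , z∈y)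

  ⊆-antisym : ∀ {x y} → x ⊆ y → y ⊆ x → x ≡ y
  ⊆-antisym x⊆y y⊆x = extensionality λ _ → mk⇔ x⊆y y⊆x

  ∩-comm : ∀ x y → x ∩ y ≡ y ∩ x
  ∩-comm x y = ⊆-antisym (from ∈-∩ ∘ swap ∘ to ∈-∩) (from ∈-∩ ∘ swap ∘ to ∈-∩)

  ∩-absorb : ∀ {x y z} → z ⊆ y → (x ∩ y) ∩ z ≡ x ∩ z
  ∩-absorb {x} {y} {z} z⊆y = ⊆-antisym forget restore
    where
    forget : (x ∩ y) ∩ z ⊆ x ∩ z
    forget w∈ with to ∈-∩ w∈
    ... | w∈xy , w∈z = from ∈-∩ (proj₁ (to ∈-∩ w∈xy) , w∈z)

    restore : x ∩ z ⊆ (x ∩ y) ∩ z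
    restore w∈ with to ∈-∩ w∈
    ... | w∈x , w∈z = from ∈-∩ (from ∈-∩ (w∈x , z⊆y w∈z) , w∈z)

  -- Foundation in the form that rules out finite cycles of `∈`: in the set of all members of a
  -- cycle, each has a predecessor.
  no-descent : ∀ {s a} → a ∈ s → ¬ (∀ {y} → y ∈ s → ∃[ z ] (z ∈ s × z ∈ y))
  no-descent {s} {a} a∈s pred with foundation s (a , a∈s)
  ... | y , y∈s , y-min with pred y∈s
  ...   | z , z∈s , z∈y = y-min z∈s z∈y

  ∈-asym : ∀ {a b} → a ∈ b → b ∉ a
  ∈-asym {a} {b} a∈b b∈a = no-descent a∈s pred
    where
    s = pair a b

    a∈s : a ∈ s
    a∈s = from ∈-pair (inj₁ refl)

    b∈s : b ∈ s
    b∈s = from ∈-pair (inj₂ refl)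

    pred : ∀ {y} → y ∈ s → ∃[ z ] (z ∈ s × z ∈ y)
    pred y∈s with to ∈-pair y∈s
    ... | inj₁ refl = b , b∈s , b∈a
    ... | inj₂ refl = a , a∈s , a∈b

  ∈-irrefl : ∀ {a} → a ∉ a
  ∈-irrefl a∈a = ∈-asym a∈a a∈a

  ∈-no-3-cycle : ∀ {a b c} → a ∈ b → b ∈ c → c ∉ a
  ∈-no-3-cycle {a} {b} {c} a∈b b∈c c∈a = no-descent a∈s pred
    where
    s = pair a b ∪ pair c c

    a∈s : a ∈ s
    a∈s = from ∈-∪ (inj₁ (from ∈-pair (inj₁ refl)))

    b∈s : b ∈ s
    b∈s = from ∈-∪ (inj₁ (from ∈-pair (inj₂ refl)))

    c∈s : c ∈ s
    c∈s = from ∈-∪ (inj₂ (from ∈-pair (inj₁ refl)))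

    pred : ∀ {y} → y ∈ s → ∃[ z ] (z ∈ s × z ∈ y)
    pred y∈s with to ∈-∪ y∈s
    ... | inj₁ y∈ab with to ∈-pair y∈ab
    ...   | inj₁ refl = c , c∈s , c∈a
    ...   | inj₂ refl = a , a∈s , a∈b
    pred y∈s | inj₂ y∈cc with to ∈-pair y∈cc
    ...   | inj₁ refl = b , b∈s , b∈c
    ...   | inj₂ refl = b , b∈s , b∈c

  -- Transitivity of `α` brings `z` into `α`, where it can be compared with `β`; any outcome other
  -- than `z ∈ β` closes a membership cycle of length two or three.
  ordinal-element-transitive : ∀ {α β} → Ordinal α → β ∈ α → Transitive β
  ordinal-element-transitive (α-trans , α-tri) β∈α y∈β z∈y
    with α-tri (α-trans (α-trans β∈α y∈β) z∈y) β∈α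
  ... | inj₁ z∈β         = z∈β
  ... | inj₂ (inj₁ refl) = ⊥-elim (∈-asym z∈y y∈β)
  ... | inj₂ (inj₂ β∈z)  = ⊥-elim (∈-no-3-cycle z∈y y∈β β∈z)

module ComparisonPoints {ℓ : Level} {U : ZFC ℓ} (S : Setting U) where
  open SetTheory U
  open Setting S
  open SetLemmas U

  SkClosure-mono : ∀ {a b} → a ⊆ b → ∀ {x} → SkClosure a x → SkClosure b x
  SkClosure-mono a⊆b (base x∈a)     = base (a⊆b x∈a)
  SkClosure-mono a⊆b (step φ xs cl) = step φ xs (SkClosure-mono a⊆b ∘ cl)

  Sk-mono : ∀ {a b} → a ⊆ b → Sk a ⊆ Sk b
  Sk-mono a⊆b = from ∈-sep ∘ map₂ (SkClosure-mono a⊆b) ∘ to ∈-sep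

  Γ⊆ω₂ : Γ ⊆ ω₂
  Γ⊆ω₂ = proj₁ ∘ to ∈-sep ∘ Γ⊆Λ

  -- `β` competes with `γ` to be the least element of `Γ ∖ sup (N ∩ γ)`: no `y` in `N` can have `β`
  -- as a member, since `N ⊆ β` already gives `y ∈ β`.
  Γ-bounded : ∀ {N β γ} → β ∈ Γ → N ⊆ β → γ ∈ Γ[ N ] → γ ≤ β
  Γ-bounded {N} {β} {γ} β∈Γ N⊆β γ∈ΓN = proj₂ (proj₂ (to ∈-sep γ∈ΓN)) (from ∈-sep (β∈Γ , β∉sup))
    where
    β∉sup : β ∉ sup (N ∩ γ)
    β∉sup β∈ with to ∈-⋃ β∈
    ... | y , y∈ , β∈y = ∈-asym β∈y (N⊆β (proj₁ (to ∈-∩ y∈)))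

  ≤⇒⊆ : ∀ {β γ} → β ∈ Γ → γ ≤ β → γ ⊆ β
  ≤⇒⊆ β∈Γ (inj₁ γ∈β) = ordinal-element-transitive (proj₁ isω₂) (Γ⊆ω₂ β∈Γ) γ∈β
  ≤⇒⊆ β∈Γ (inj₂ refl) = id

  Γ-bounded-⊆ : ∀ {N β γ} → β ∈ Γ → N ⊆ β → γ ∈ Γ[ N ] → γ ⊆ β
  Γ-bounded-⊆ β∈Γ N⊆β γ∈ΓN = ≤⇒⊆ β∈Γ (Γ-bounded β∈Γ N⊆β γ∈ΓN)

  -- Whether `γ` lies in `Γ[ M ]` depends on `M` only through `sup (M ∩ γ)`.
  Γ[]-local : ∀ {M M′ γ} → M ∩ γ ≡ M′ ∩ γ → γ ∈ Γ[ M ] → γ ∈ Γ[ M′ ]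
  Γ[]-local {γ = γ} eq =
    from ∈-sep ∘ map₂ (subst (λ a → IsLeast (Γ ∖ sup a) γ) eq) ∘ to ∈-sep

  -- Intersecting with `Γ[ N ]` keeps every candidate `γ` inside `β`, where cutting `M` down to `β`
  -- changes nothing. Without `Γ[ N ]` the sets may differ, as nothing bounds `Γ[ M ]` by `β`.
  Γ[]-truncate : ∀ {M N β} → β ∈ Γ → N ⊆ β → Γ[ M ∩ β ] ∩ Γ[ N ] ≡ Γ[ M ] ∩ Γ[ N ]
  Γ[]-truncate {M} {N} {β} β∈Γ N⊆β = ⊆-antisym
    (λ γ∈ → let γ∈M , γ∈N = to ∈-∩ γ∈
            in from ∈-∩ (Γ[]-local (∩-absorb (Γ-bounded-⊆ β∈Γ N⊆β γ∈N)) γ∈M , γ∈N))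
    (λ γ∈ → let γ∈M , γ∈N = to ∈-∩ γ∈
            in from ∈-∩ (Γ[]-local (sym (∩-absorb (Γ-bounded-⊆ β∈Γ N⊆β γ∈N))) γ∈M , γ∈N))

  -- This is definitionally the pairwise clause of `Adequate`, so adequacy hypotheses supply and
  -- consume it directly.
  Comparable : V → V → Set ℓ
  Comparable M N =
    ∃[ γ ] (IsComparisonPoint M N γ × (M ∩ γ ≡ N ∩ γ ⊎ M ∩ γ ∈ Sk N ⊎ N ∩ γ ∈ Sk M))

  Comparable-sym : ∀ {M N} → Comparable M N → Comparable N M
  Comparable-sym {M} {N} (γ , γ-largest , rel) =
    γ , subst (λ s → IsLargest s γ) (∩-comm Γ[ M ] Γ[ N ]) γ-largest , map sym ⊎-swap rel

  Comparable-extend : ∀ {M N β} → β ∈ Γ → N ⊆ β → Comparable (M ∩ β) N → Comparable M N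
  Comparable-extend {M} {N} {β} β∈Γ N⊆β (γ , γ-largest , rel) =
    γ , subst (λ s → IsLargest s γ) (Γ[]-truncate β∈Γ N⊆β) γ-largest , extend rel
    where
    M∩β∩γ≡M∩γ : (M ∩ β) ∩ γ ≡ M ∩ γ
    M∩β∩γ≡M∩γ = ∩-absorb (Γ-bounded-⊆ β∈Γ N⊆β (proj₂ (to ∈-∩ (proj₁ γ-largest))))

    extend : (M ∩ β) ∩ γ ≡ N ∩ γ ⊎ (M ∩ β) ∩ γ ∈ Sk N ⊎ N ∩ γ ∈ Sk (M ∩ β) →
             M ∩ γ ≡ N ∩ γ ⊎ M ∩ γ ∈ Sk N ⊎ N ∩ γ ∈ Sk M
    -- The same `γ` serves both pairs. The first two alternatives only need `(M ∩ β) ∩ γ` rewritten;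
    -- in the third, `M ∩ β` occurs only under `Sk`, and the hull grows to `Sk M`.
    extend = map (trans (sym M∩β∩γ≡M∩γ))
                 (map (subst (_∈ Sk N) M∩β∩γ≡M∩γ) (Sk-mono (proj₁ ∘ to ∈-∩)))

proposition3p11 : ∀ {ℓ : Level} → ExcludedMiddle ℓ → (U : ZFC ℓ) (S : Setting U) →
    let open SetTheory U
        open Setting S
    in ∀ {A B β : V} →
    Adequate A → β ∈ Γ → Closed β A →
    Adequate B → A ∩ 𝒫 β ⊆ B → B ⊆ 𝒫 β →
    Adequate (A ∪ B)
proposition3p11 _ U S {A} {B} {β} (A⊆𝒳 , A-comp) β∈Γ A-closed (B⊆𝒳 , B-comp) A∩𝒫β⊆B B⊆𝒫β =
  ([ A⊆𝒳 , B⊆𝒳 ]′ ∘ to ∈-∪) , λ M∈ N∈ → compare (to ∈-∪ M∈) (to ∈-∪ N∈)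
  where
  open SetTheory U
  open Setting S
  open SetLemmas U
  open ComparisonPoints S

  mixed : ∀ {M N} → M ∈ A → N ∈ B → Comparable M N
  mixed M∈A N∈B = Comparable-extend β∈Γ (to ∈-𝒫 (B⊆𝒫β N∈B)) (B-comp M∩β∈B N∈B)
    where
    -- `β`-closure keeps the truncation in `A`; being a subset of `β`, it then falls into `B`, where
    -- adequacy of `B` compares it with `N`.
    M∩β∈B = A∩𝒫β⊆B (from ∈-∩ (A-closed M∈A , from ∈-𝒫 (proj₂ ∘ to ∈-∩)))

  compare : ∀ {M N} → M ∈ A ⊎ M ∈ B → N ∈ A ⊎ N ∈ B → Comparable M N
  compare (inj₁ M∈A) (inj₁ N∈A) = A-comp M∈A N∈A
  compare (inj₁ M∈A) (inj₂ N∈B) = mixed M∈A N∈B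
  -- Only the member of `A` may reach beyond `β`, so the roles are exchanged before truncating.
  compare (inj₂ M∈B) (inj₁ N∈A) = Comparable-sym (mixed N∈A M∈B)
  compare (inj₂ M∈B) (inj₂ N∈B) = B-comp M∈B N∈B
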